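{- There exists an infinite word over the ternary alphabet $\{0,1,2\}$ that is $\tfrac{41}{22}^+$-free and avoids overpals, i.e., has no factor that is an overpal.
   Context: For a nonempty finite word $u$ and a rational $r>1$, a word $v$ is an $r$-power (of $u$) if $v$ is a prefix of the infinite periodic word $uuu\cdots$ and $|v|/|u|=r$. A word is $\beta^+$-free if none of its factors is an $r$-power with $r>\beta$. An overpal is a word of the form $axax^Ra$, where $a$ is a single letter, $x$ is a (possibly empty) finite word, and $x^R$ is the reversal of $x$. -}

module Defs where

open import Data.Integer.Base using (+_)
open import Data.List.Base using (List; []; _∷_; _++_; applyUpTo; length; lookup; reverse)
open import Data.List.NonEmpty.Base as List⁺ using (List⁺)
open import Data.Nat.Base using (ℕ; _+_)
open import Data.Nat.DivMod using (_mod_)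
open import Data.Product.Base using (∃-syntax; _×_)
open import Data.Rational.Base using (ℚ; 1ℚ; _/_; _<_)
open import Relation.Binary.PropositionalEquality.Core using (_≡_)
open import Relation.Nullary.Negation.Core using (¬_)

InfiniteWord : Set → Set
InfiniteWord A = ℕ → A

module _ {A : Set} where

  infix 4 _PrefixOf_ _FactorOf_

  _PrefixOf_ : List A → InfiniteWord A → Set
  v PrefixOf w = v ≡ applyUpTo w (length v)

  _FactorOf_ : List A → InfiniteWord A → Set
  v FactorOf w = ∃[ i ] v PrefixOf (λ k → w (i + k))

  _^ω : List⁺ A → InfiniteWord A
  (u ^ω) k = lookup (List⁺.toList u) (k mod List⁺.length u)

  IsPowerOf : ℚ → List A → List⁺ A → Set
  IsPowerOf r v u = 1ℚ < r × v PrefixOf (u ^ω) × (+ length v) / List⁺.length u ≡ r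

  IsPower : ℚ → List A → Set
  IsPower r v = ∃[ u ] IsPowerOf r v u

  -- Powers of exponent exactly β are allowed.
  _⁺-Free : ℚ → InfiniteWord A → Set
  (β ⁺-Free) w = ∀ v → v FactorOf w → ∀ r → β < r → ¬ IsPower r v

  IsOverpal : List A → Set
  IsOverpal v = ∃[ a ] ∃[ x ] v ≡ a ∷ x ++ a ∷ reverse x ++ a ∷ []

  AvoidsOverpals : InfiniteWord A → Set
  AvoidsOverpals w = ∀ v → v FactorOf w → ¬ IsOverpal v

{-# OPTIONS --safe #-}
-- A 6-uniform morphism on the letters `short a`, `long a` (a modulo 3) has a fixed point ψ,
-- and w is its image under the spelling `short a` ↦ a, `long a` ↦ a (a+1) (a+2) (a+1).
-- A repetition of ψ whose period is not a multiple of 6 is too short to matter, because 13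
-- letters of ψ determine their position modulo 6; a period 6q comes from a repetition of
-- period q, and the run of matches e (length minus period) grows at most from e to 6e + 3.
-- Hence 25e + 15 ≤ 21p is inherited from level to level.  Along with it goes the bound
-- 22(E + 3) ≤ 19P on the spelled lengths E, P of run and period; it gives exponent at most
-- 41/22 for w, since a run of w exceeds the spelling of the corresponding run of ψ by at most 3.
-- Everything else is a check of finitely many windows.  In a ternary word without short
-- squares, avoiding overpals amounts to avoiding palindromes of length 7.

module Submission where

open import Defs
open import Data.Fin.Base using (Fin)
open import Data.Integer.Base using (+_)
open import Data.Product.Base using (Σ-syntax; _×_)
open import Data.Rational.Base using (_/_)

open import Algebra.Properties.CommutativeSemigroup using (x∙yz≈y∙xz; xy∙z≈y∙xz)
open import Data.Bool.Base using (Bool; true; false; if_then_else_)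
open import Data.Empty using (⊥)
open import Data.Fin.Base using (toℕ)
open import Data.Fin.Patterns using (0F; 1F; 2F; 3F; 4F; 5F)
open import Data.Fin.Properties as Fin using (toℕ<n; toℕ-injective; toℕ-fromℕ<)
import Data.Integer.Base as ℤ
import Data.Integer.Properties as ℤ
open import Data.List.Base using (List; []; _∷_; _++_; applyUpTo; concatMap; drop; length; lookup; reverse; take)
open import Data.List.Membership.Propositional using (_∈_)
open import Data.List.NonEmpty.Base as List⁺ using (List⁺; _∷_)
open import Data.List.Properties as List using (≡-dec)
open import Data.List.Relation.Unary.All as All using (All; all?)
open import Data.List.Relation.Unary.Any using (here; there)
open import Data.Nat hiding (_/_)
open import Data.Nat.Base using () renaming (_/_ to infixl 7 _div_)
open import Data.Nat.DivMod hiding (_/_; _div_)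
open import Data.Nat.Divisibility using (_∣_; _∣?_; divides; divides-refl; n∣m*n; ∣m+n∣m⇒∣n)
open import Data.Nat.Induction using (<-rec)
open import Data.Nat.Properties
open import Data.Nat.Tactic.RingSolver using (solve-∀)
open import Data.Product.Base using (∃-syntax; _,_; proj₁; proj₂)
import Data.Product.Properties as Product
import Data.Rational.Base as ℚ
import Data.Rational.Properties as ℚ
import Data.Rational.Unnormalised.Base as ℚᵘ
import Data.Rational.Unnormalised.Properties as ℚᵘ
open import Data.Sum.Base using (_⊎_; inj₁; inj₂)
open import Data.Vec.Base as Vec using (Vec; []; _∷_; toList)
open import Function.Base using (_∘_; _$_)
open import Relation.Binary.Definitions using (DecidableEquality)
open import Relation.Binary.PropositionalEquality
open import Relation.Nullary.Decidable using (Dec; yes; no; does; map′; toWitness; _×-dec_; _→-dec_; ¬?)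
open import Relation.Nullary.Negation using (¬_; contradiction)

private variable
  A : Set

-- Windows of infinite words and runs of matches.

window : InfiniteWord A → ℕ → ℕ → List A
window f i zero    = []
window f i (suc n) = f i ∷ window f (suc i) n

window-++ : ∀ (f : InfiniteWord A) i m n →
            window f i (m + n) ≡ window f i m ++ window f (m + i) n
window-++ f i zero    n = refl
window-++ f i (suc m) n = cong (f i ∷_) (trans (window-++ f (suc i) m n)
  (cong (λ k → window f (suc i) m ++ window f k n) (+-suc m i)))

take-window : ∀ (f : InfiniteWord A) i {m n} → m ≤ n → take m (window f i n) ≡ window f i m
take-window f i z≤n       = refl
take-window f i (s≤s m≤n) = cong (f i ∷_) (take-window f (suc i) m≤n)

drop-window : ∀ (f : InfiniteWord A) i m n → drop m (window f i (m + n)) ≡ window f (m + i) n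
drop-window f i zero    n = refl
drop-window f i (suc m) n = trans (drop-window f (suc i) m n) (cong (λ k → window f k n) (+-suc m i))

take-drop-window : ∀ (f : InfiniteWord A) i {m n l} → m + n ≤ l →
                   take n (drop m (window f i l)) ≡ window f (m + i) n
take-drop-window f i {m} {n} {l} m+n≤l with k , refl ← m≤n⇒∃[o]m+o≡n m+n≤l
  rewrite +-assoc m n k | drop-window f i m (n + k) = take-window f (m + i) (m≤m+n n k)

Matches : InfiniteWord A → ℕ → ℕ → ℕ → Set
Matches f p i j = ∀ n → i ≤ n → n < j → f n ≡ f (p + n)

window-cong : ∀ (f : InfiniteWord A) p i {j} n → Matches f p i j → n + i ≤ j →
              window f i n ≡ window f (p + i) n
window-cong f p i zero    f≈ n+i≤j = refl
window-cong f p i (suc n) f≈ n+i≤j = cong₂ _∷_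
  (f≈ i ≤-refl (≤-trans (s≤s (m≤n+m i n)) n+i≤j))
  (trans (window-cong f p (suc i) n (λ k i<k → f≈ k (<⇒≤ i<k)) (≤-trans (≤-reflexive (+-suc n i)) n+i≤j))
         (cong (λ k → window f k n) (+-suc p i)))

-- The morphism, its spelling and its adjacent pairs.

rot : Fin 3 → Fin 3
rot 0F = 1F
rot 1F = 2F
rot 2F = 0F

data Letter : Set where
  short long : Fin 3 → Letter

_≟ᴸ_ : DecidableEquality Letter
short a ≟ᴸ short b = map′ (cong short) (λ { refl → refl }) (a Fin.≟ b)
long  a ≟ᴸ long  b = map′ (cong long)  (λ { refl → refl }) (a Fin.≟ b)
short _ ≟ᴸ long _  = no λ ()
long  _ ≟ᴸ short _ = no λ ()

children : Letter → Vec Letter 6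
children (short a) = short a ∷ long (rot a) ∷ short (rot a) ∷ short (rot (rot a)) ∷ long a ∷ short a ∷ []
children (long a)  = short a ∷ long (rot a) ∷ short (rot a) ∷ long (rot (rot a)) ∷ short (rot (rot a)) ∷ long a ∷ []

child : Letter → Fin 6 → Letter
child = Vec.lookup ∘ children

spell : Letter → List (Fin 3)
spell (short a) = a ∷ []
spell (long a)  = a ∷ rot a ∷ rot (rot a) ∷ rot a ∷ []

size : Letter → ℕ
size = length ∘ spell

weight : List Letter → ℕ
weight = length ∘ concatMap spell

expand : List Letter → List Letter
expand = concatMap (toList ∘ children)

-- These pairs fix the difference of w where a block ends: -1 after a long block, 1 after a short
-- one.
bigrams : List (Letter × Letter)
bigrams = concatMap (λ a → (long a , short a) ∷ (short a , short (rot a)) ∷ (short a , long (rot a)) ∷ [])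
                    (0F ∷ 1F ∷ 2F ∷ [])

letters : List Letter
letters = short 0F ∷ short 1F ∷ short 2F ∷ long 0F ∷ long 1F ∷ long 2F ∷ []

∈-letters : ∀ x → x ∈ letters
∈-letters (short 0F) = here refl
∈-letters (short 1F) = there (here refl)
∈-letters (short 2F) = there (there (here refl))
∈-letters (long 0F)  = there (there (there (here refl)))
∈-letters (long 1F)  = there (there (there (there (here refl))))
∈-letters (long 2F)  = there (there (there (there (there (here refl)))))

_≟ᴮ_ : DecidableEquality (Letter × Letter)
_≟ᴮ_ = Product.≡-dec _≟ᴸ_ _≟ᴸ_

open import Data.List.Membership.DecPropositional _≟ᴮ_ using (_∈?_)

-- Finite checks on windows.

lcp : List Letter → List Letter → ℕ
lcp (x ∷ xs) (y ∷ ys) = if does (x ≟ᴸ y) then suc (lcp xs ys) else 0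
lcp _ _ = 0

-- In ψ the patterns 10100 and 00101 (long = 1, short = 0) occur only at positions 5 modulo 6.
-- A window of 13 letters containing neither is a factor of 010010010…, and its last four letters
-- determine the phase.
residue : List Letter → ℕ
residue (long _ ∷ short _ ∷ long _ ∷ short _ ∷ short _ ∷ _) = 5
residue (short _ ∷ short _ ∷ long _ ∷ short _ ∷ long _ ∷ _) = 5
residue (short _ ∷ long _ ∷ short _ ∷ short _ ∷ [])         = 3
residue (long _ ∷ short _ ∷ short _ ∷ long _ ∷ [])          = 4
residue (short _ ∷ short _ ∷ long _ ∷ short _ ∷ [])         = 5
residue []       = 0
residue (_ ∷ xs) = (5 + residue xs) % 6

-- The clause e < 13 certifies that the run of matches ends inside a window of 29 = 16 + 13 letters,
-- so that `lcp` measures it in full for every p ≤ 16.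
SmallPeriods : List Letter → Set
SmallPeriods u = ∀ p → p < 17 → 1 ≤ p → let e = lcp u (drop p u) in
  e < 13 × 25 * e + 15 ≤ 21 * p × (3 ≤ p → 22 * weight (take e u) + 66 ≤ 19 * weight (take p u))

-- `weight-2` excludes periods of one or two blocks once the spelled period is at least 6;
-- `weight-12` and `weight-17` settle runs of at most 12 letters with period at least 17.
record Admissible (r : ℕ) (u : List Letter) : Set where
  field
    small      : SmallPeriods u
    weight-2   : weight (take 2 u) ≤ 5
    weight-12  : weight (take 12 u) ≤ 27
    weight-17  : 35 ≤ weight (take 17 u)
    residue-13 : residue (take 13 u) ≡ r % 6

smallPeriods? : ∀ u → Dec (SmallPeriods u)
smallPeriods? u = map′ (λ h p → h {p}) (λ h {p} → h p) $ allUpTo? (λ p → 1 ≤? p →-dec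
   let e = lcp u (drop p u) in
   e <? 13 ×-dec 25 * e + 15 ≤? 21 * p ×-dec (3 ≤? p →-dec 22 * weight (take e u) + 66 ≤? 19 * weight (take p u))) 17

admissible? : ∀ r u → Dec (Admissible r u)
admissible? r u = map′
  (λ (a , b , c , d , e) → record { small = a ; weight-2 = b ; weight-12 = c ; weight-17 = d ; residue-13 = e })
  (λ l → let open Admissible l in small , weight-2 , weight-12 , weight-17 , residue-13)
  (smallPeriods? u ×-dec weight (take 2 u) ≤? 5 ×-dec weight (take 12 u) ≤? 27
    ×-dec 35 ≤? weight (take 17 u) ×-dec residue (take 13 u) ≟ r % 6)

-- Every window of at most 37 letters of ψ lies in the twofold expansion of two adjacent letters.
expand² : Letter × Letter → List Letter
expand² (x , y) = expand (expand (x ∷ y ∷ []))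

OnWindows : ℕ → (ℕ → List Letter → Set) → Set
OnWindows n Q = All (λ b → ∀ {r} → r < 36 → Q r (take n (drop r (expand² b)))) bigrams

onWindows? : ∀ n {Q} → (∀ r u → Dec (Q r u)) → Dec (OnWindows n Q)
onWindows? n Q? = all? (λ b → allUpTo? (λ r → Q? r (take n (drop r (expand² b)))) 36) bigrams

windows-admissible : OnWindows 29 Admissible
windows-admissible = toWitness {a? = onWindows? 29 admissible?} _

-- The fixed point ψ.

ψ-upTo : ℕ → InfiniteWord Letter
ψ-upTo zero       n = short 0F
ψ-upTo (suc fuel) n = child (ψ-upTo fuel (n div 6)) (n mod 6)

n/6≤ : ∀ {n m} → n ≤ suc m → n div 6 ≤ m
n/6≤ {zero}  _   = z≤n
n/6≤ {suc n} n≤m = ≤-pred (<-≤-trans (m/n<m (suc n) 6 (s≤s (s≤s z≤n))) n≤m)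

-- Surplus fuel is harmless: division by 6 lowers a positive index, and at index 0 the letter
-- `short 0F` is its own first child.
ψ-upTo-stable : ∀ {k l n} → n ≤ k → n ≤ l → ψ-upTo k n ≡ ψ-upTo l n
ψ-upTo-stable {zero}  {zero}  _   _   = refl
ψ-upTo-stable {zero}  {suc l} z≤n _   rewrite sym (ψ-upTo-stable {zero} {l} z≤n z≤n) = refl
ψ-upTo-stable {suc k} {zero}  _   z≤n rewrite ψ-upTo-stable {k} {zero} z≤n z≤n = refl
ψ-upTo-stable {suc k} {suc l} n≤k n≤l =
  cong (λ x → child x _) (ψ-upTo-stable (n/6≤ n≤k) (n/6≤ n≤l))

abstract
  ψ : InfiniteWord Letter
  ψ n = ψ-upTo n n

  -- The fixed-point equation of the morphism; all later facts about ψ rest on it.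
  ψ-children : ∀ k (r : Fin 6) → ψ (toℕ r + k * 6) ≡ child (ψ k) r
  ψ-children k r = trans (ψ-upTo-stable {l = suc n} ≤-refl (n≤1+n n))
    (cong₂ child
      (trans (ψ-upTo-stable (subst (_≤ n) (sym quotient) k≤n) ≤-refl) (cong ψ quotient))
      (toℕ-injective (trans (toℕ-fromℕ< _) (trans ([m+kn]%n≡m%n (toℕ r) k 6) (m<n⇒m%n≡m (toℕ<n r))))))
    where
    n : ℕ
    n = toℕ r + k * 6

    k≤n : k ≤ n
    k≤n = ≤-trans (m≤m*n k 6) (m≤n+m (k * 6) (toℕ r))

    quotient : n div 6 ≡ k
    quotient = trans (+-distrib-/-∣ʳ (toℕ r) (n∣m*n k))
      (cong₂ _+_ (m<n⇒m/n≡0 (toℕ<n r)) (m*n/n≡m k 6))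

window-ψ : ∀ k m → window ψ (k * 6) (m * 6) ≡ expand (window ψ k m)
window-ψ k zero    = refl
window-ψ k (suc m)
  rewrite ψ-children k 0F | ψ-children k 1F | ψ-children k 2F
        | ψ-children k 3F | ψ-children k 4F | ψ-children k 5F | window-ψ (suc k) m = block (ψ k)
  where
  block : ∀ x {ys} → child x 0F ∷ child x 1F ∷ child x 2F ∷
                     child x 3F ∷ child x 4F ∷ child x 5F ∷ ys
                   ≡ toList (children x) ++ ys
  block (short a) = refl
  block (long a)  = refl

children-bigrams : ∀ x → (child x 0F , child x 1F) ∈ bigrams × (child x 1F , child x 2F) ∈ bigrams ×
                         (child x 2F , child x 3F) ∈ bigrams × (child x 3F , child x 4F) ∈ bigrams ×
                         (child x 4F , child x 5F) ∈ bigrams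
children-bigrams x = All.lookup (toWitness {a? = all? (λ x →
  (child x 0F , child x 1F) ∈? bigrams ×-dec (child x 1F , child x 2F) ∈? bigrams ×-dec
  (child x 2F , child x 3F) ∈? bigrams ×-dec (child x 3F , child x 4F) ∈? bigrams ×-dec
  (child x 4F , child x 5F) ∈? bigrams) letters} _) (∈-letters x)

next-bigram : ∀ {b} → b ∈ bigrams → (child (proj₁ b) 5F , child (proj₂ b) 0F) ∈ bigrams
next-bigram = All.lookup (toWitness {a? = all? (λ b → (child (proj₁ b) 5F , child (proj₂ b) 0F) ∈? bigrams) bigrams} _)

-- Inside a block the pair is a bigram whatever the parent is. Across a boundary, n = 5 + 6k, it
-- comes from the pair of parents at the smaller index k.
ψ-bigram : ∀ n → (ψ n , ψ (suc n)) ∈ bigrams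
ψ-bigram = <-rec _ λ n rec → go n rec (n divMod 6)
  where
  inside : ∀ k (r s : Fin 6) → toℕ s ≡ suc (toℕ r) → (child (ψ k) r , child (ψ k) s) ∈ bigrams →
           (ψ (toℕ r + k * 6) , ψ (suc (toℕ r + k * 6))) ∈ bigrams
  inside k r s s≡ ∈b = subst (_∈ bigrams) (cong₂ _,_ (sym (ψ-children k r))
    (trans (sym (ψ-children k s)) (cong (λ t → ψ (t + k * 6)) s≡))) ∈b

  go : ∀ n → (∀ {m} → m < n → (ψ m , ψ (suc m)) ∈ bigrams) → DivMod n 6 → (ψ n , ψ (suc n)) ∈ bigrams
  go _ rec (result k 0F refl) = inside k 0F 1F refl (proj₁ (children-bigrams (ψ k)))
  go _ rec (result k 1F refl) = inside k 1F 2F refl (proj₁ (proj₂ (children-bigrams (ψ k))))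
  go _ rec (result k 2F refl) = inside k 2F 3F refl (proj₁ (proj₂ (proj₂ (children-bigrams (ψ k)))))
  go _ rec (result k 3F refl) = inside k 3F 4F refl (proj₁ (proj₂ (proj₂ (proj₂ (children-bigrams (ψ k))))))
  go _ rec (result k 4F refl) = inside k 4F 5F refl (proj₂ (proj₂ (proj₂ (proj₂ (children-bigrams (ψ k))))))
  go _ rec (result k 5F refl) = subst (_∈ bigrams)
    (cong₂ _,_ (sym (ψ-children k 5F)) (sym (ψ-children (suc k) 0F)))
    (next-bigram (rec (s≤s (≤-trans (m≤m*n k 6) (m≤n+m (k * 6) 4)))))

-- Makes a finite check valid along all of ψ: with k = n div 36, the twofold images of ψ k and its
-- right neighbour have 72 = 35 + 37 letters, enough for a window of N letters from any offset below
-- 36.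
window-local : ∀ (Q : ℕ → List Letter → Set) N → N ≤ 37 → OnWindows N Q →
               ∀ n → Q (n % 36) (window ψ n N)
window-local Q N N≤37 checked n = subst (Q (n % 36)) eq
  (All.lookup checked (ψ-bigram k) (m%n<n n 36))
  where
  k : ℕ
  k = n div 36

  grand≡ : expand² (ψ k , ψ (suc k)) ≡ window ψ (k * 6 * 6) 72
  grand≡ = trans (cong expand (sym (window-ψ k 2))) (sym (window-ψ (k * 6) 12))

  eq : take N (drop (n % 36) (expand² (ψ k , ψ (suc k)))) ≡ window ψ n N
  eq = trans (cong (take N ∘ drop (n % 36)) grand≡)
    (trans (take-drop-window ψ (k * 6 * 6) (+-mono-≤ (≤-pred (m%n<n n 36)) N≤37))
      (cong (λ i → window ψ i N) (trans (cong (λ m → n % 36 + m) (*-assoc k 6 6)) (sym (m≡m%n+[m/n]*n n 36)))))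

ψ-local : ∀ n → Admissible (n % 36) (window ψ n 29)
ψ-local = window-local Admissible 29 (m≤m+n 29 8) windows-admissible

-- Reduces a consequence of linear inequalities, summed up in a ≤ b, to a semiring identity;
-- s is the slack.
≤-linear : ∀ s {a b l r} → a ≤ b → l + b + s ≡ r + a → l ≤ r
≤-linear s {a} {b} {l} {r} a≤b eq = +-cancelʳ-≤ a l r (≤-trans (+-monoʳ-≤ l a≤b)
  (≤-trans (m≤m+n (l + b) s) (≤-reflexive eq)))

m≤n⇒∃[o]o+m≡n : ∀ {m n} → m ≤ n → ∃[ o ] o + m ≡ n
m≤n⇒∃[o]o+m≡n m≤n = _ , m∸n+n≡m m≤n

-- Spelled lengths as differences of positions.

-- The block of w spelled by ψ k starts at position k.
position : ℕ → ℕ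
position zero    = 0
position (suc n) = size (ψ n) + position n

weight-∷ : ∀ x xs → weight (x ∷ xs) ≡ size x + weight xs
weight-∷ x xs = List.length-++ (spell x)

weight-window : ∀ i n → weight (window ψ i n) + position i ≡ position (n + i)
weight-window i zero    = refl
weight-window i (suc n) = begin
  weight (window ψ i (suc n)) + position i               ≡⟨ cong (_+ position i) (weight-∷ (ψ i) (window ψ (suc i) n)) ⟩
  size (ψ i) + weight (window ψ (suc i) n) + position i  ≡⟨ xy∙z≈y∙xz +-commutativeSemigroup (size (ψ i)) _ (position i) ⟩
  weight (window ψ (suc i) n) + position (suc i)         ≡⟨ weight-window (suc i) n ⟩
  position (n + suc i)                                   ≡⟨ cong position (+-suc n i) ⟩
  position (suc n + i)                                   ∎
  where open ≡-Reasoning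

size-positive : ∀ x → 1 ≤ size x
size-positive (short _) = s≤s z≤n
size-positive (long _)  = s≤s z≤n

position-expansive : ∀ m i → m + position i ≤ position (m + i)
position-expansive zero    i = ≤-refl
position-expansive (suc m) i = +-mono-≤ (size-positive (ψ (m + i))) (position-expansive m i)

position-mono : ∀ {i j} → i ≤ j → position i ≤ position j
position-mono {i} i≤j with m , refl ← m≤n⇒∃[o]m+o≡n i≤j =
  ≤-trans (m≤n+m (position i) m) (≤-trans (position-expansive m i) (≤-reflexive (cong position (+-comm m i))))

-- Both kinds of blocks begin with letters of sizes 1, 4, 1. These are the three letters by which a
-- run can outlast the images of its parent run.
position-half-block : ∀ k → position (3 + k * 6) ≡ 6 + position (k * 6)
position-half-block k rewrite ψ-children k 0F | ψ-children k 1F | ψ-children k 2F = first-half (ψ k)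
  where
  first-half : ∀ x {n} → size (child x 2F) + (size (child x 1F) + (size (child x 0F) + n)) ≡ 6 + n
  first-half (short _) = refl
  first-half (long _)  = refl

-- An image spells 11 letters more than its parent does: 12 against 1, or 15 against 4.
position-block : ∀ k → position (k * 6) ≡ position k + 11 * k
position-block zero    = refl
position-block (suc k) = begin
  position (6 + k * 6)                            ≡⟨ weight-window (k * 6) 6 ⟨
  weight (window ψ (k * 6) 6) + position (k * 6)  ≡⟨ cong (λ u → weight u + position (k * 6)) (window-ψ k 1) ⟩
  weight (expand (ψ k ∷ [])) + position (k * 6)   ≡⟨ cong₂ _+_ (weight-children (ψ k)) (position-block k) ⟩
  size (ψ k) + 11 + (position k + 11 * k)         ≡⟨ rearrange (size (ψ k)) (position k) k ⟩
  size (ψ k) + position k + 11 * suc k            ∎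
  where
  open ≡-Reasoning
  weight-children : ∀ x → weight (expand (x ∷ [])) ≡ size x + 11
  weight-children (short _) = refl
  weight-children (long _)  = refl

  rearrange : ∀ s q k → s + 11 + (q + 11 * k) ≡ s + q + 11 * suc k
  rearrange = solve-∀

weight-take : ∀ i {m n} → m ≤ n → weight (take m (window ψ i n)) + position i ≡ position (m + i)
weight-take i {m} m≤n = trans (cong (λ u → weight u + position i) (take-window ψ i m≤n)) (weight-window i m)

position-2+≤ : ∀ i → position (2 + i) ≤ 5 + position i
position-2+≤ i =
  subst (_≤ 5 + position i) (weight-take i (m≤m+n 2 27))
    (+-monoˡ-≤ (position i) (Admissible.weight-2 (ψ-local i)))

position-12+≤ : ∀ i → position (12 + i) ≤ 27 + position i
position-12+≤ i =
  subst (_≤ 27 + position i) (weight-take i (m≤m+n 12 17))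
    (+-monoˡ-≤ (position i) (Admissible.weight-12 (ψ-local i)))

≤position-17+ : ∀ i → 35 + position i ≤ position (17 + i)
≤position-17+ i =
  subst (35 + position i ≤_) (weight-take i (m≤m+n 17 12))
    (+-monoˡ-≤ (position i) (Admissible.weight-17 (ψ-local i)))

ψ-residue : ∀ i → residue (window ψ i 13) ≡ i % 6
ψ-residue i = trans (sym (cong residue (take-window ψ i (m≤m+n 13 16))))
  (trans (Admissible.residue-13 (ψ-local i)) (m∣n⇒o%n%m≡o%m 6 36 i (divides 6 refl)))

-- Runs of ψ with small period, or with period not divisible by 6.

lcp-++ : ∀ zs {xs ys} → length zs ≤ lcp (zs ++ xs) (zs ++ ys)
lcp-++ []       = z≤n
lcp-++ (z ∷ zs) with z ≟ᴸ z
... | yes _  = s≤s (lcp-++ zs)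
... | no z≢z = contradiction refl z≢z

length-window : ∀ (f : InfiniteWord A) i n → length (window f i n) ≡ n
length-window f i zero    = refl
length-window f i (suc n) = cong suc (length-window f (suc i) n)

lcp-window : ∀ f p i {e j} n → Matches f p i j → e + i ≤ j → p + e ≤ n →
             e ≤ lcp (window f i n) (drop p (window f i n))
lcp-window f p i {e} n f≈ e+i≤j p+e≤n with m , refl ← m≤n⇒∃[o]m+o≡n p+e≤n
  = subst₂ _≤_ (length-window f i e) (cong₂ lcp left right) (lcp-++ (window f i e))
  where
  left : window f i e ++ window f (e + i) (p + m) ≡ window f i (p + e + m)
  left = trans (sym (window-++ f i e (p + m))) (cong (window f i) (swap e p m))
    where
    swap : ∀ e p m → e + (p + m) ≡ p + e + m
    swap = solve-∀

  right : window f i e ++ window f (e + (p + i)) m ≡ drop p (window f i (p + e + m))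
  right = trans (cong (_++ window f (e + (p + i)) m) (window-cong f p i e f≈ e+i≤j))
    (trans (sym (window-++ f (p + i) e m))
      (trans (sym (drop-window f i p (e + m))) (cong (drop p ∘ window f i) (sym (+-assoc p e m)))))

-- For a run e = j - i these say 25e + 15 ≤ 21p and 22(E + 3) ≤ 19P, with the subtractions moved
-- to the other side.  The run 12 of the period 15 attains the first; the second can fail for p ≤ 2.
Bounds : ℕ → ℕ → ℕ → Set
Bounds p i j = 25 * j + 15 ≤ 21 * p + 25 * i ×
               (3 ≤ p → 22 * position j + 66 ≤ 19 * position (p + i) + 3 * position i)

bounds-+ : ∀ p i e l {w v} → e ≤ l → w + position i ≡ position (l + i) → v + position i ≡ position (p + i) →
           25 * l + 15 ≤ 21 * p → (3 ≤ p → 22 * w + 66 ≤ 19 * v) → Bounds p i (e + i)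
bounds-+ p i e l {w} {v} e≤l w+position-i v+position-i l-bound w-bound
  = ≤-linear 0 (+-mono-≤ (*-monoʳ-≤ 25 e≤l) l-bound) (shift e l i p)
  , λ 3≤p → subst (λ q → 22 * position (e + i) + 66 ≤ 19 * q + 3 * position i) v+position-i
      (combine (position (e + i)) w v (position i)
        (≤-trans (position-mono (+-monoˡ-≤ i e≤l)) (≤-reflexive (sym w+position-i))) (w-bound 3≤p))
  where
  shift : ∀ e l i p → 25 * (e + i) + 15 + (25 * l + 21 * p) + 0 ≡ 21 * p + 25 * i + (25 * e + (25 * l + 15))
  shift = solve-∀

  exchange : ∀ a b c d → 22 * a + 66 + (22 * (b + d) + 19 * c) + 0 ≡ 19 * (c + d) + 3 * d + (22 * a + (22 * b + 66))
  exchange = solve-∀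

  combine : ∀ a b c d → a ≤ b + d → 22 * b + 66 ≤ 19 * c → 22 * a + 66 ≤ 19 * (c + d) + 3 * d
  combine a b c d a≤ b≤ = ≤-linear 0 (+-mono-≤ (*-monoʳ-≤ 22 a≤) b≤) (exchange a b c d)

-- For a run e possibly longer than the window: comparing at most c letters suffices, since a
-- measured value l below c rules out e ≥ c.
≤-capped : ∀ {e l c} → l < c → (e ≤ c → e ≤ l) → (c ≤ e → c ≤ l) → e ≤ l
≤-capped {e} {l} {c} l<c below above with ≤-total e c
... | inj₁ e≤c = below e≤c
... | inj₂ c≤e = contradiction (above c≤e) (<⇒≱ l<c)

bounds-small : ∀ p i e → 1 ≤ p → p < 17 → Matches ψ p i (e + i) → Bounds p i (e + i)
bounds-small p i e 1≤p p<17 ψ≈ =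
  bounds-+ p i e L {weight (take L u)} {weight (take p u)} e≤L
    (weight-take i (≤-trans (<⇒≤ (proj₁ small)) (m≤m+n 13 16)))
    (weight-take i (≤-trans p≤16 (m≤m+n 16 13))) (proj₁ (proj₂ small)) (proj₂ (proj₂ small))
  where
  u : List Letter
  u = window ψ i 29

  L : ℕ
  L = lcp u (drop p u)

  small : L < 13 × 25 * L + 15 ≤ 21 * p × (3 ≤ p → 22 * weight (take L u) + 66 ≤ 19 * weight (take p u))
  small = Admissible.small (ψ-local i) p p<17 1≤p

  p≤16 : p ≤ 16
  p≤16 = ≤-pred p<17

  e≤L : e ≤ L
  e≤L = ≤-capped (proj₁ small)
    (λ e≤13 → lcp-window ψ p i 29 ψ≈ ≤-refl (+-mono-≤ p≤16 e≤13))
    (λ 13≤e → lcp-window ψ p i 29 ψ≈ (+-monoˡ-≤ i 13≤e) (+-monoˡ-≤ 13 p≤16))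

-- At the extremes e = 12 and p = 17 the bounds read 315 ≤ 357 and 22 (27 + 3) = 660 ≤ 665 = 19 *
-- 35.
bounds-short : ∀ p i e → 17 ≤ p → e ≤ 12 → Bounds p i (e + i)
bounds-short p i e 17≤p e≤12 =
    ≤-linear 42 (+-mono-≤ (*-monoʳ-≤ 25 e≤12) (*-monoʳ-≤ 21 17≤p)) (length-identity e i p)
  , λ _ → ≤-linear 5 (+-mono-≤ (*-monoʳ-≤ 22 position-j≤) (*-monoʳ-≤ 19 ≤position-p))
            (weight-identity (position (e + i)) (position (p + i)) (position i))
  where
  position-j≤ : position (e + i) ≤ 27 + position i
  position-j≤ = ≤-trans (position-mono (+-monoˡ-≤ i e≤12)) (position-12+≤ i)

  ≤position-p : 35 + position i ≤ position (p + i)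
  ≤position-p = ≤-trans (≤position-17+ i) (position-mono (+-monoˡ-≤ i 17≤p))

  length-identity : ∀ e i p → 25 * (e + i) + 15 + (25 * 12 + 21 * p) + 42 ≡ 21 * p + 25 * i + (25 * e + 21 * 17)
  length-identity = solve-∀

  weight-identity : ∀ a q d → 22 * a + 66 + (22 * (27 + d) + 19 * q) + 5 ≡ 19 * q + 3 * d + (22 * a + 19 * (35 + d))
  weight-identity = solve-∀

%-≡⇒∣ : ∀ p n d .{{_ : NonZero d}} → n % d ≡ (p + n) % d → d ∣ p
%-≡⇒∣ p n d n≡p+n = ∣m+n∣m⇒∣n (divides ((p + n) div d) multiple) (n∣m*n (n div d))
  where
  open ≡-Reasoning
  multiple : n div d * d + p ≡ (p + n) div d * d
  multiple = +-cancelˡ-≡ (n % d) _ _ (begin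
    n % d + (n div d * d + p)        ≡⟨ +-assoc (n % d) _ p ⟨
    n % d + n div d * d + p          ≡⟨ cong (_+ p) (m≡m%n+[m/n]*n n d) ⟨
    n + p                            ≡⟨ +-comm n p ⟩
    p + n                            ≡⟨ m≡m%n+[m/n]*n (p + n) d ⟩
    (p + n) % d + (p + n) div d * d  ≡⟨ cong (_+ (p + n) div d * d) n≡p+n ⟨
    n % d + (p + n) div d * d        ∎)

-- A run of 13 letters gives equal windows at i and p + i, and `residue` reads the position modulo 6
-- off either of them.
synchronised : ∀ p i e → Matches ψ p i (e + i) → ¬ 6 ∣ p → e ≤ 12
synchronised p i e ψ≈ 6∤p with e ≤? 12
... | yes e≤12 = e≤12
... | no  e≰12 = contradiction (%-≡⇒∣ p i 6 (begin
    i % 6                          ≡⟨ ψ-residue i ⟨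
    residue (window ψ i 13)        ≡⟨ cong residue (window-cong ψ p i 13 ψ≈ (+-monoˡ-≤ i (≰⇒> e≰12))) ⟩
    residue (window ψ (p + i) 13)  ≡⟨ ψ-residue (p + i) ⟩
    (p + i) % 6                    ∎)) 6∤p
  where open ≡-Reasoning

-- Desubstitution of periods divisible by 6.

-- The two kinds of blocks agree in the positions 0, 1, 2 and differ in 3, 4, 5.
LateInjective : Letter → Letter → Set
LateInjective x y = (child x 3F ≡ child y 3F → x ≡ y) × (child x 4F ≡ child y 4F → x ≡ y) ×
                    (child x 5F ≡ child y 5F → x ≡ y)

late-injective : ∀ x y → LateInjective x y
late-injective x y = All.lookup (All.lookup (toWitness {a? = all? (λ x → all? (λ y →
  (child x 3F ≟ᴸ child y 3F →-dec x ≟ᴸ y) ×-dec (child x 4F ≟ᴸ child y 4F →-dec x ≟ᴸ y) ×-dec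
  (child x 5F ≟ᴸ child y 5F →-dec x ≟ᴸ y)) letters) letters} _) (∈-letters x)) (∈-letters y)

module _ (q i j : ℕ) (i<j : i < j) (ψ≈ : Matches ψ (q * 6) i j) where

  child-match : ∀ m r → i ≤ toℕ r + m * 6 → toℕ r + m * 6 < j → child (ψ m) r ≡ child (ψ (q + m)) r
  child-match m r ≤n n< = trans (sym (ψ-children m r)) (trans (ψ≈ _ ≤n n<)
    (trans (cong ψ (shift q m (toℕ r))) (ψ-children (q + m) r)))
    where
    shift : ∀ q m t → q * 6 + (t + m * 6) ≡ t + (q + m) * 6
    shift = solve-∀

  -- The larger of i and 3 + 6m lies in the run and is one of the positions 3, 4, 5 of block m. A
  -- single late child identifies the parent, so a partly covered first block is not lost.
  parent-match : ∀ m → i < 6 + m * 6 → 3 + m * 6 < j → ψ m ≡ ψ (q + m)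
  parent-match m i< <j with i ≤? 3 + m * 6 | i ≤? 4 + m * 6
  ... | yes i≤3 | _       = proj₁ (late-injective _ _) (child-match m 3F i≤3 <j)
  ... | no  i≰3 | yes i≤4 = proj₁ (proj₂ (late-injective _ _)) (child-match m 4F i≤4
                              (≤-<-trans (≰⇒> i≰3) i<j))
  ... | no  i≰3 | no i≰4  = proj₂ (proj₂ (late-injective _ _)) (child-match m 5F (≤-pred i<)
                              (≤-<-trans (≰⇒> i≰4) i<j))

  parents-match : Matches ψ q (i div 6) ((2 + j) div 6)
  parents-match m i/6≤m m< = parent-match m
    (≤-trans (m<[1+m/n]*n i) (*-monoˡ-≤ 6 (s≤s i/6≤m)))
    -- The shift by 2 is exact: m < (2 + j) div 6 holds just when 3 + 6m < j.
    (+-cancelˡ-≤ 2 _ _ (≤-trans (*-monoˡ-≤ 6 m<) (m/n*n≤m (2 + j) 6)))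
    where
    m<[1+m/n]*n : ∀ n → n < suc (n div 6) * 6
    m<[1+m/n]*n n = ≤-trans (s≤s (≤-reflexive (m≡m%n+[m/n]*n n 6))) (+-monoˡ-≤ (n div 6 * 6) (m%n<n n 6))

j≤3+ : ∀ j → j ≤ 3 + (2 + j) div 6 * 6
j≤3+ j = +-cancelˡ-≤ 2 _ _ (≤-trans (≤-reflexive (m≡m%n+[m/n]*n (2 + j) 6))
  (+-monoˡ-≤ ((2 + j) div 6 * 6) (≤-pred (m%n<n (2 + j) 6))))

-- The length bound reproduces itself, since 25 (6e + 3) + 15 = 6 (25e + 15). For the spelled
-- lengths, E grows by at most 11e + 6 and P by 11q, up to the rounding of i, which is common to
-- both.
bounds-lift : ∀ q k l i j → k * 6 ≤ i → j ≤ 3 + l * 6 → 3 ≤ q → Bounds q k l → Bounds (q * 6) i j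
bounds-lift q k l i j k*6≤i j≤ 3≤q (length-bound , weight-bound) =
    ≤-linear 0 (+-mono-≤ (*-monoʳ-≤ 25 j≤) (+-mono-≤ (*-monoʳ-≤ 6 length-bound) (*-monoʳ-≤ 25 k*6≤i)))
      (length-identity j l q k i)
  , λ _ → ≤-linear 0 (+-mono-≤ (*-monoʳ-≤ 22 position-j≤) (+-mono-≤ (weight-bound 3≤q) (+-mono-≤ slack
            (+-mono-≤ (*-monoʳ-≤ 19 ≤position-p) (*-monoʳ-≤ 3 ≤position-i)))))
      (weight-identity (position j) (position (q * 6 + i)) (position i) (position l)
        (position (q + k)) (position k) l q k)
  where
  length-identity : ∀ j l q k i →
    25 * j + 15 + (25 * (3 + l * 6) + (6 * (21 * q + 25 * k) + 25 * i)) + 0 ≡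
    21 * (q * 6) + 25 * i + (25 * j + (6 * (25 * l + 15) + 25 * (k * 6)))
  length-identity = solve-∀

  weight-identity : ∀ a c d x y z l q k →
    22 * a + 66 + (22 * (6 + (x + 11 * l)) + (19 * y + 3 * z + (209 * q + 242 * k + (19 * c + 3 * d)))) + 0 ≡
    19 * c + 3 * d + (22 * a + (22 * x + 66 + (242 * l + 132 + (19 * (y + 11 * (q + k)) + 3 * (z + 11 * k)))))
  weight-identity = solve-∀

  slack-identity : ∀ l q k → 25 * (242 * l + 132) + 242 * (21 * q + 25 * k) + (143 * q + 330) ≡
                             25 * (209 * q + 242 * k) + 242 * (25 * l + 15)
  slack-identity = solve-∀

  -- With e = l - k this is 22 (11e + 6) ≤ 19 * 11q, the growth of the two sides of the weight
  -- bound. It follows from the length bound because 242 * 21 / 25 < 209.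
  slack : 242 * l + 132 ≤ 209 * q + 242 * k
  slack = *-cancelˡ-≤ 25 (≤-linear (143 * q + 330) (*-monoʳ-≤ 242 length-bound) (slack-identity l q k))

  position-j≤ : position j ≤ 6 + (position l + 11 * l)
  position-j≤ = ≤-trans (position-mono j≤)
    (≤-reflexive (trans (position-half-block l) (cong (λ m → 6 + m) (position-block l))))

  ≤position-i : position k + 11 * k ≤ position i
  ≤position-i = ≤-trans (≤-reflexive (sym (position-block k))) (position-mono k*6≤i)

  ≤position-p : position (q + k) + 11 * (q + k) ≤ position (q * 6 + i)
  ≤position-p = ≤-trans (≤-reflexive (trans (sym (position-block (q + k))) (cong position (*-distribʳ-+ 6 q k))))
                (position-mono (+-monoʳ-≤ (q * 6) k*6≤i))

BoundsAt : ℕ → Set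
BoundsAt p = 1 ≤ p → ∀ i j → i ≤ j → Matches ψ p i j → Bounds p i j

bounds-step : ∀ p → (∀ {q} → q < p → BoundsAt q) → BoundsAt p
bounds-step p rec 1≤p i j i≤j ψ≈ with e , refl ← m≤n⇒∃[o]o+m≡n i≤j | p <? 17 | 6 ∣? p
... | yes p<17 | _       = bounds-small p i e 1≤p p<17 ψ≈
... | no  p≮17 | no 6∤p  = bounds-short p i e (≮⇒≥ p≮17) (synchronised p i e ψ≈ 6∤p)
... | no  p≮17 | yes (divides-refl q) = go e ψ≈
  where
  -- From 17 ≤ 6q; hence the weight bound, which may fail for periods 1 and 2, is available for q.
  3≤q : 3 ≤ q
  3≤q = *-cancelʳ-< 6 2 q (≤-trans (m≤m+n 13 4) (≮⇒≥ p≮17))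

  go : ∀ e → Matches ψ p i (e + i) → Bounds p i (e + i)
  -- Desubstitution needs a nonempty run.
  go zero    _  = bounds-short p i 0 (≮⇒≥ p≮17) z≤n
  go (suc e) ψ≈ = bounds-lift q (i div 6) l i (suc e + i) (m/n*n≤m i 6) (j≤3+ (suc e + i)) 3≤q
    (rec (m<m*n q 6 {{>-nonZero 1≤q}} (s≤s (s≤s z≤n))) 1≤q (i div 6) l (/-monoˡ-≤ 6 (m≤n+m i (3 + e)))
      (parents-match q i (suc e + i) (s≤s (m≤n+m i e)) ψ≈))
    where
    l : ℕ
    l = (3 + e + i) div 6

    1≤q : 1 ≤ q
    1≤q = ≤-trans (s≤s z≤n) 3≤q

bounds : ∀ p → BoundsAt p
bounds = <-rec BoundsAt bounds-step

-- The ternary word w and the decoding of its blocks.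

letterAt : Letter → ℕ → Fin 3
letterAt (short a) _ = a
letterAt (long a)  0 = a
letterAt (long a)  1 = rot a
letterAt (long a)  2 = rot (rot a)
letterAt (long a)  _ = rot a

advance : Letter → ℕ × ℕ → ℕ × ℕ
advance (short _) (k , _) = suc k , 0
advance (long _)  (k , 3) = suc k , 0
advance (long _)  (k , o) = k , suc o

location : ℕ → ℕ × ℕ
location zero    = 0 , 0
location (suc n) = advance (ψ (proj₁ (location n))) (location n)

abstract
  w : InfiniteWord (Fin 3)
  w n = letterAt (ψ (proj₁ (location n))) (proj₂ (location n))

  location-step : ∀ n {k o x} → ψ k ≡ x → location n ≡ (k , o) → location (suc n) ≡ advance x (k , o)
  location-step n refl n≡ = cong (λ l → advance (ψ (proj₁ l)) l) n≡

  w-at : ∀ n {k o x} → ψ k ≡ x → location n ≡ (k , o) → w n ≡ letterAt x o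
  w-at n refl n≡ = cong (λ l → letterAt (ψ (proj₁ l)) (proj₂ l)) n≡

  -- ψ k is generalised to x so that a case split on x lets `advance` compute through the block.
  read : ∀ k n x → ψ k ≡ x → location n ≡ (k , 0) →
         window w n (size x) ≡ spell x × location (size x + n) ≡ (suc k , 0)
  read k n (short a) x≡ n≡ = cong (_∷ []) (w-at n x≡ n≡) , location-step n x≡ n≡
  read k n (long a)  x≡ n≡ =
      cong₂ _∷_ (w-at n x≡ n≡) (cong₂ _∷_ (w-at (1 + n) x≡ l₁) (cong₂ _∷_ (w-at (2 + n) x≡ l₂)
        (cong (_∷ []) (w-at (3 + n) x≡ l₃))))
    , location-step (3 + n) x≡ l₃
    where
    l₁ : location (1 + n) ≡ (k , 1)
    l₁ = location-step n x≡ n≡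

    l₂ : location (2 + n) ≡ (k , 2)
    l₂ = location-step (1 + n) x≡ l₁

    l₃ : location (3 + n) ≡ (k , 3)
    l₃ = location-step (2 + n) x≡ l₂

  location-position : ∀ k → location (position k) ≡ (k , 0)
  location-position zero    = refl
  location-position (suc k) = proj₂ (read k (position k) (ψ k) refl (location-position k))

  window-spell : ∀ k n → window w (position k) (weight (window ψ k n)) ≡ concatMap spell (window ψ k n)
  window-spell k zero    = refl
  window-spell k (suc n) = begin
    window w (position k) (weight (ψ k ∷ window ψ (suc k) n))
      ≡⟨ cong (window w (position k)) (weight-∷ (ψ k) (window ψ (suc k) n)) ⟩
    window w (position k) (size (ψ k) + weight (window ψ (suc k) n))
      ≡⟨ window-++ w (position k) (size (ψ k)) (weight (window ψ (suc k) n)) ⟩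
    window w (position k) (size (ψ k)) ++ window w (position (suc k)) (weight (window ψ (suc k) n))
      ≡⟨ cong₂ _++_ (proj₁ (read k (position k) (ψ k) refl (location-position k))) (window-spell (suc k) n) ⟩
    spell (ψ k) ++ concatMap spell (window ψ (suc k) n) ∎
    where open ≡-Reasoning

-- The differences of w are 1 1 2 2 on a long block and 1 on a short one, so the first three
-- differences of a window tell the offset of its first letter in its block.
decode : List (Fin 3) → ℕ × Letter
decode (a ∷ b ∷ c ∷ d ∷ _) = choose (does (b Fin.≟ rot a)) (does (c Fin.≟ rot b)) (does (d Fin.≟ rot c))
  where
  choose : Bool → Bool → Bool → ℕ × Letter
  choose true  true  true  = 0 , short a
  choose true  true  false = 0 , long a
  choose true  false _     = 1 , long (rot (rot a))
  choose false false _     = 2 , long (rot a)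
  choose false true  _     = 3 , long (rot (rot a))
decode _ = 0 , short 0F

SquareFree≤5 : List (Fin 3) → Set
SquareFree≤5 v = ∀ {p} → p < 6 → 1 ≤ p → ¬ take p v ≡ take p (drop p v)

Readable : Letter → ℕ → List (Fin 3) → Set
Readable x o v = decode (take 4 v) ≡ (o , x) × SquareFree≤5 v × ¬ reverse (take 7 v) ≡ take 7 v

LocallyReadable : List Letter → Set
LocallyReadable []      = ⊥
LocallyReadable (x ∷ u) = ∀ {o} → o < size x → Readable x o (take 10 (drop o (concatMap spell (x ∷ u))))

readable? : ∀ x o v → Dec (Readable x o v)
readable? x o v = Product.≡-dec _≟_ _≟ᴸ_ (decode (take 4 v)) (o , x)
  ×-dec allUpTo? (λ p → 1 ≤? p →-dec ¬? (≡-dec Fin._≟_ (take p v) (take p (drop p v)))) 6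
  ×-dec ¬? (≡-dec Fin._≟_ (reverse (take 7 v)) (take 7 v))

locallyReadable? : ∀ u → Dec (LocallyReadable u)
locallyReadable? []      = no λ ()
locallyReadable? (x ∷ u) = allUpTo? (λ o → readable? x o _) (size x)

windows-readable : OnWindows 14 (λ _ → LocallyReadable)
windows-readable = toWitness {a? = onWindows? 14 (λ _ → locallyReadable?)} _

size≤4 : ∀ x → size x ≤ 4
size≤4 (short _) = s≤s z≤n
size≤4 (long _)  = ≤-refl

w-local : ∀ k o → o < size (ψ k) → Readable (ψ k) o (window w (o + position k) 10)
w-local k o o<size = subst (Readable (ψ k) o)
  (trans (cong (take 10 ∘ drop o) (sym (window-spell k 14))) (take-drop-window w (position k) o+10≤))
  (window-local (λ _ → LocallyReadable) 14 (m≤m+n 14 23) windows-readable k o<size)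
  where
  -- Fourteen blocks spell at least 14 letters, which leaves 10 after an offset of at most 4. Ten
  -- letters suffice for squares of period up to 5.
  o+10≤ : o + 10 ≤ weight (window ψ k 14)
  o+10≤ = ≤-trans (+-monoˡ-≤ 10 (≤-trans (<⇒≤ o<size) (size≤4 (ψ k))))
    (+-cancelʳ-≤ (position k) 14 _ (≤-trans (position-expansive 14 k) (≤-reflexive (sym (weight-window k 14)))))

data Located (n : ℕ) : Set where
  at : ∀ k o → o < size (ψ k) → o + position k ≡ n → Located n

locate : ∀ n → Located n
locate zero    = at 0 0 (size-positive (ψ 0)) refl
locate (suc n) with at k o o<size refl ← locate n with m≤n⇒m<n∨m≡n o<size
... | inj₁ 1+o<size = at k (suc o) 1+o<size refl
... | inj₂ 1+o≡size = at (suc k) 0 (size-positive (ψ (suc k))) (cong (_+ position k) (sym 1+o≡size))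

decode-w : ∀ k o → o < size (ψ k) → decode (window w (o + position k) 4) ≡ (o , ψ k)
decode-w k o o<size =
  trans (cong decode (sym (take-window w (o + position k) (m≤m+n 4 6)))) (proj₁ (w-local k o o<size))

w-squareFree : ∀ i p → 1 ≤ p → p < 6 → ¬ window w i p ≡ window w (p + i) p
w-squareFree i p 1≤p p<6 square with at k o o<size refl ← locate i =
  proj₁ (proj₂ (w-local k o o<size)) p<6 1≤p
    (trans (take-window w i (≤-trans (<⇒≤ p<6) (m≤m+n 6 4)))
      (trans square (sym (take-drop-window w i (+-mono-≤ (≤-pred p<6) (≤-pred p<6))))))

w-palindromeFree : ∀ i → ¬ reverse (window w i 7) ≡ window w i 7
w-palindromeFree i palindrome with at k o o<size refl ← locate i =
  proj₂ (proj₂ (w-local k o o<size))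
    (subst (λ v → reverse v ≡ v) (sym (take-window w i (m≤m+n 7 3))) palindrome)

-- Transfer of the bounds from ψ to w.

position-suc-cong : ∀ {p} k l → ψ k ≡ ψ l → position l ≡ p + position k →
                    position (suc l) ≡ p + position (suc k)
position-suc-cong {p} k l ψ≡ position≡ =
  trans (cong₂ (λ x n → size x + n) (sym ψ≡) position≡)
    (x∙yz≈y∙xz +-commutativeSemigroup (size (ψ k)) p (position k))

matches-[] : ∀ (f : InfiniteWord A) p i → Matches f p i i
matches-[] f p i n i≤n n<i = contradiction n<i (≤⇒≯ i≤n)

matches-∷ : ∀ (f : InfiniteWord A) p {i j} → f i ≡ f (p + i) → Matches f p (suc i) j → Matches f p i j
matches-∷ f p f≡ f≈ n i≤n n<j with m≤n⇒m<n∨m≡n i≤n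
... | inj₁ i<n  = f≈ n i<n n<j
... | inj₂ refl = f≡

-- Walks along the blocks. While four letters of the run remain, `decode` reads the same block at
-- both places; equal blocks have equal size, so the next starts are again p apart. At most three
-- letters are left over.
extend : ∀ p q j n k → j ≤ n + k → position (q + k) ≡ p + position k → Matches w p (position k) j →
         ∃[ l ] k ≤ l × Matches ψ q k l × j ≤ 3 + position l
extend p q j zero    k j≤ position≡ w≈ =
  -- Without fuel j ≤ k ≤ `position k`, so the run is used up.
  k , ≤-refl , matches-[] ψ q k ,
  ≤-trans j≤ (≤-trans k≤position-k (m≤n+m (position k) 3))
  where
  k≤position-k : k ≤ position k
  k≤position-k = ≤-trans (≤-reflexive (sym (+-identityʳ k)))
    (≤-trans (position-expansive k 0) (≤-reflexive (cong position (+-identityʳ k))))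
extend p q j (suc n) k j≤ position≡ w≈ with j ≤? 3 + position k
... | yes j≤3+ = k , ≤-refl , matches-[] ψ q k , j≤3+
... | no  j≰3+ = l , <⇒≤ k<l , matches-∷ ψ q ψ≡ ψ≈ , j≤l
  where
  ψ≡ : ψ k ≡ ψ (q + k)
  ψ≡ = cong proj₂ (begin
    (0 , ψ k)                               ≡⟨ decode-w k 0 (size-positive (ψ k)) ⟨
    decode (window w (position k) 4)        ≡⟨ cong decode (window-cong w p (position k) 4 w≈ (≰⇒> j≰3+)) ⟩
    decode (window w (p + position k) 4)    ≡⟨ cong (λ i → decode (window w i 4)) position≡ ⟨
    decode (window w (position (q + k)) 4)  ≡⟨ decode-w (q + k) 0 (size-positive (ψ (q + k))) ⟩
    (0 , ψ (q + k))                         ∎)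
    where open ≡-Reasoning

  rest : ∃[ l ] suc k ≤ l × Matches ψ q (suc k) l × j ≤ 3 + position l
  rest = extend p q j n (suc k) (≤-trans j≤ (≤-reflexive (sym (+-suc n k))))
    (trans (cong position (+-suc q k)) (position-suc-cong k (q + k) ψ≡ position≡))
    (λ i start<i → w≈ i (≤-trans (m≤n+m (position k) (size (ψ k))) start<i))

  l = proj₁ rest
  k<l = proj₁ (proj₂ rest)
  ψ≈ = proj₁ (proj₂ (proj₂ rest))
  j≤l = proj₂ (proj₂ (proj₂ rest))

period≥3 : ∀ {p} q k → 6 ≤ p → position (q + k) ≡ p + position k → 3 ≤ q
period≥3 q k 6≤p position≡ = ≮⇒≥ λ q<3 → contradiction
  (≤-trans (≤-reflexive (sym position≡)) (≤-trans (position-mono (+-monoˡ-≤ k (≤-pred q<3))) (position-2+≤ k)))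
  (<⇒≱ (+-monoˡ-≤ (position k) 6≤p))

-- The run may start inside block k, whose agreement is a hypothesis, so the walk starts at k + 1.
-- Here P = p, and the 3 in 22 (E + 3) ≤ 19P absorbs the leftover letters.
aligned-bound : ∀ p q k o j → 6 ≤ p → o < size (ψ k) → ψ k ≡ ψ (q + k) → position (q + k) ≡ p + position k →
                Matches w p (o + position k) j → 22 * j ≤ 19 * p + 22 * (o + position k)
aligned-bound p q k o j 6≤p o<size ψ≡ position≡ w≈ = conclude
  (extend p q j j (suc k) (m≤m+n j (suc k))
    (trans (cong position (+-suc q k)) (position-suc-cong k (q + k) ψ≡ position≡))
    (λ i start≤i → w≈ i (≤-trans (+-monoˡ-≤ (position k) (<⇒≤ o<size)) start≤i)))
  where
  3≤q : 3 ≤ q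
  3≤q = period≥3 q k 6≤p position≡

  identity : ∀ j x y z p o →
    22 * j + (22 * (3 + x) + (19 * y + 3 * z + (19 * (p + z) + 22 * (o + z)))) + 0 ≡
    19 * p + 22 * (o + z) + (22 * j + (22 * x + 66 + (19 * y + 22 * z)))
  identity = solve-∀

  conclude : ∃[ l ] suc k ≤ l × Matches ψ q (suc k) l × j ≤ 3 + position l →
             22 * j ≤ 19 * p + 22 * (o + position k)
  conclude (l , k<l , ψ≈ , j≤) = ≤-linear 0
    (+-mono-≤ (*-monoʳ-≤ 22 j≤) (+-mono-≤
      (proj₂ (bounds q (≤-trans (s≤s z≤n) 3≤q) k l (<⇒≤ k<l) (matches-∷ ψ q ψ≡ ψ≈)) 3≤q)
      (+-mono-≤ (*-monoʳ-≤ 19 (≤-reflexive position≡)) (*-monoʳ-≤ 22 (m≤n+m (position k) o)))))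
    (identity j (position l) (position (q + k)) (position k) p o)

-- Four matching letters decode to the same offset and block letter at i and at p + i, so the two
-- blocks start exactly p apart.
located-bound : ∀ p i j → 6 ≤ p → 4 + i ≤ j → Matches w p i j → Located i → Located (p + i) →
                22 * j ≤ 19 * p + 22 * i
located-bound p _ j 6≤p 4+i≤j w≈ (at k o o<size refl) (at k′ o′ o′<size eq) = conclude (≤-total k k′)
  where
  same : (o , ψ k) ≡ (o′ , ψ k′)
  same = begin
    (o , ψ k)                                   ≡⟨ decode-w k o o<size ⟨
    decode (window w (o + position k) 4)        ≡⟨ cong decode (window-cong w p (o + position k) 4 w≈ 4+i≤j) ⟩
    decode (window w (p + (o + position k)) 4)  ≡⟨ cong (λ i → decode (window w i 4)) eq ⟨
    decode (window w (o′ + position k′) 4)      ≡⟨ decode-w k′ o′ o′<size ⟩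
    (o′ , ψ k′)                                 ∎
    where open ≡-Reasoning

  position≡ : position k′ ≡ p + position k
  position≡ = +-cancelˡ-≡ o _ _ (begin
    o + position k′       ≡⟨ cong (_+ position k′) (cong proj₁ same) ⟩
    o′ + position k′      ≡⟨ eq ⟩
    p + (o + position k)  ≡⟨ x∙yz≈y∙xz +-commutativeSemigroup p o (position k) ⟩
    o + (p + position k)  ∎)
    where open ≡-Reasoning

  forward : ∀ {k′} → ∃[ q ] q + k ≡ k′ → ψ k ≡ ψ k′ → position k′ ≡ p + position k →
            22 * j ≤ 19 * p + 22 * (o + position k)
  forward (q , refl) ψ≡ position≡ = aligned-bound p q k o j 6≤p o<size ψ≡ position≡ w≈

  conclude : k ≤ k′ ⊎ k′ ≤ k → 22 * j ≤ 19 * p + 22 * (o + position k)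
  conclude (inj₁ k≤k′) = forward (m≤n⇒∃[o]o+m≡n k≤k′) (cong proj₂ same) position≡
  conclude (inj₂ k′≤k) = contradiction (≤-trans (≤-reflexive (sym position≡)) (position-mono k′≤k))
    (<⇒≱ (+-monoˡ-≤ (position k) (≤-trans (s≤s z≤n) 6≤p)))

-- For a run e = j - i this is 22e ≤ 19p, that is, exponent (p + e) / p ≤ 41/22.
w-bound : ∀ p i j → 1 ≤ p → Matches w p i j → 22 * j ≤ 19 * p + 22 * i
w-bound p i j 1≤p w≈ with p <? 6 | p + i ≤? j | 4 + i ≤? j
... | yes p<6 | yes p+i≤j | _ = contradiction (window-cong w p i p w≈ p+i≤j) (w-squareFree i p 1≤p p<6)
-- Here e ≤ p - 1, and 22 (p - 1) ≤ 19p as p ≤ 5.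
... | yes p<6 | no  p+i≰j | _ = ≤-linear 7
  (+-mono-≤ (*-monoʳ-≤ 22 (≰⇒> p+i≰j)) (*-monoʳ-≤ 3 (≤-pred p<6))) (identity j p i)
  where
  identity : ∀ j p i → 22 * j + (22 * (p + i) + 15) + 7 ≡ 19 * p + 22 * i + (22 * (1 + j) + 3 * p)
  identity = solve-∀
... | no p≮6 | _ | yes 4+i≤j = located-bound p i j (≮⇒≥ p≮6) 4+i≤j w≈ (locate i) (locate (p + i))
-- Too short to decode, but 22 * 3 = 66 ≤ 114 = 19 * 6.
... | no p≮6 | _ | no 4+i≰j = ≤-linear 48
  (+-mono-≤ (*-monoʳ-≤ 22 (≤-pred (≰⇒> 4+i≰j))) (*-monoʳ-≤ 19 (≮⇒≥ p≮6))) (identity j p i)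
  where
  identity : ∀ j p i → 22 * j + (22 * (3 + i) + 19 * p) + 48 ≡ 19 * p + 22 * i + (22 * j + 19 * 6)
  identity = solve-∀

-- Factors, powers and overpals of w.

applyUpTo-window : ∀ (f g : InfiniteWord A) i n → (∀ k → f k ≡ g (k + i)) → applyUpTo f n ≡ window g i n
applyUpTo-window f g i zero    f≡g = refl
applyUpTo-window f g i (suc n) f≡g = cong₂ _∷_ (f≡g 0)
  (applyUpTo-window (f ∘ suc) g (suc i) n (λ k → trans (f≡g (suc k)) (cong g (sym (+-suc k i)))))

applyUpTo-injective : ∀ (f g : InfiniteWord A) {n k} → applyUpTo f n ≡ applyUpTo g n → k < n → f k ≡ g k
applyUpTo-injective f g {suc n} {zero}  f≡g _         = List.∷-injectiveˡ f≡g
applyUpTo-injective f g {suc n} {suc k} f≡g (s≤s k<n) =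
  applyUpTo-injective (f ∘ suc) (g ∘ suc) (List.∷-injectiveʳ f≡g) k<n

factor⇒window : ∀ {f : InfiniteWord A} {v} → v FactorOf f → ∃[ i ] v ≡ window f i (length v)
factor⇒window {f = f} {v} (i , v≡) = i , trans v≡ (applyUpTo-window _ f i (length v) (λ k → cong f (+-comm i k)))

infix-window : ∀ (f : InfiniteWord A) i us vs ws → us ++ vs ++ ws ≡ window f i (length (us ++ vs ++ ws)) →
               vs ≡ window f (length us + i) (length vs)
infix-window f i []       []       ws eq = refl
infix-window f i []       (v ∷ vs) ws eq = cong₂ _∷_ (List.∷-injectiveˡ eq)
  (infix-window f (suc i) [] vs ws (List.∷-injectiveʳ eq))
infix-window f i (u ∷ us) vs       ws eq = trans (infix-window f (suc i) us vs ws (List.∷-injectiveʳ eq))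
  (cong (λ k → window f k (length vs)) (+-suc (length us) i))

^ω-periodic : ∀ (u : List⁺ A) k → (u ^ω) k ≡ (u ^ω) (List⁺.length u + k)
^ω-periodic (x ∷ xs) k = cong (lookup (x ∷ xs)) (toℕ-injective (begin
  toℕ (k mod p)        ≡⟨ toℕ-fromℕ< _ ⟩
  k % p                ≡⟨ [m+n]%n≡m%n k p ⟨
  (k + p) % p          ≡⟨ cong (_% p) (+-comm k p) ⟩
  (p + k) % p          ≡⟨ toℕ-fromℕ< _ ⟨
  toℕ ((p + k) mod p)  ∎))
  where
  open ≡-Reasoning
  p : ℕ
  p = suc (length xs)

power-matches : ∀ (f : InfiniteWord A) i v u e → v PrefixOf (λ k → f (i + k)) → v PrefixOf (u ^ω) →
                e + List⁺.length u ≡ length v → Matches f (List⁺.length u) i (e + i)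
power-matches f i v u e v≡f v≡u e+p≡n n i≤n n<e+i with t , refl ← m≤n⇒∃[o]o+m≡n i≤n = begin
  f (t + i)        ≡⟨ cong f (+-comm t i) ⟩
  f (i + t)        ≡⟨ letter t (<-≤-trans t<e (≤-trans (m≤m+n e p) (≤-reflexive e+p≡n))) ⟩
  (u ^ω) t         ≡⟨ ^ω-periodic u t ⟩
  (u ^ω) (p + t)   ≡⟨ letter (p + t) (<-≤-trans (+-monoʳ-< p t<e) (≤-reflexive (trans (+-comm p e) e+p≡n))) ⟨
  f (i + (p + t))  ≡⟨ cong f (trans (+-comm i (p + t)) (+-assoc p t i)) ⟩
  f (p + (t + i))  ∎
  where
  open ≡-Reasoning
  p : ℕ
  p = List⁺.length u

  t<e : t < e
  t<e = +-cancelʳ-< i t e n<e+i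

  letter : ∀ k → k < length v → f (i + k) ≡ (u ^ω) k
  letter k = applyUpTo-injective (λ k → f (i + k)) (u ^ω) (trans (sym v≡f) v≡u)

-- Fractions in ℚ are kept in lowest terms, so the comparison moves to unnormalised rationals before
-- cross-multiplication.
/-<⇒ : ∀ a b c d → (+ a) / suc b ℚ.< (+ c) / suc d → a * suc d < c * suc b
/-<⇒ a b c d a/b<c/d = ℤ.drop‿+<+ (subst₂ ℤ._<_ (sym (ℤ.pos-* a (suc d))) (sym (ℤ.pos-* c (suc b)))
  (ℚᵘ.drop-*<* (ℚᵘ.<-respˡ-≃ (ℚ.toℚᵘ-fromℚᵘ (ℚᵘ.mkℚᵘ (+ a) b))
    (ℚᵘ.<-respʳ-≃ (ℚ.toℚᵘ-fromℚᵘ (ℚᵘ.mkℚᵘ (+ c) d)) (ℚ.toℚᵘ-mono-< a/b<c/d)))))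

w-powerFree : ((+ 41 / 22) ⁺-Free) w
w-powerFree v (i , v≡w) _ β<r (u@(_ ∷ xs) , _ , v≡u , refl) =
  contradiction (≤-trans excess (≤-linear 0 (w-bound p i (e + i) (s≤s z≤n) matches) (identity e i p))) (<⇒≱ ≤-refl)
  where
  p : ℕ
  p = suc (length xs)

  exceeds : 41 * p < length v * 22
  exceeds = /-<⇒ 41 21 (length v) (length xs) β<r

  p≤n : p ≤ length v
  p≤n = *-cancelʳ-≤ p (length v) 22
    (≤-trans (≤-trans (≤-reflexive (*-comm p 22)) (*-monoˡ-≤ p (m≤m+n 22 19))) (<⇒≤ exceeds))

  e : ℕ
  e = length v ∸ p

  matches : Matches w p i (e + i)
  matches = power-matches w i v u e v≡w v≡u (m∸n+n≡m p≤n)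

  excess : suc (41 * p) ≤ (e + p) * 22
  excess = subst (λ n → 41 * p < n * 22) (sym (m∸n+n≡m p≤n)) exceeds

  identity : ∀ e i p → (e + p) * 22 + (19 * p + 22 * i) + 0 ≡ 41 * p + 22 * (e + i)
  identity = solve-∀

-- An overpal is (ax) a (ax)^R, an odd palindrome centred at its middle a.
centre : ∀ {a : A} {x z} → reverse (a ∷ x) ≡ z → a ∷ x ++ a ∷ reverse x ++ a ∷ [] ≡ reverse z ++ a ∷ z
centre {a = a} {x} refl =
  cong₂ (λ l r → l ++ a ∷ r) (sym (List.reverse-involutive (a ∷ x))) (sym (List.unfold-reverse a x))

-- An empty x gives the square aa, a single letter b the square abab. For longer x each half has at
-- least three letters, and the middle seven letters form a palindrome.
w-overpalFree : AvoidsOverpals w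
w-overpalFree v v∈w (a , x , refl) with i , v≡ ← factor⇒window v∈w = go x v≡
  where
  go : ∀ x {i} → a ∷ x ++ a ∷ reverse x ++ a ∷ [] ≡ window w i (length (a ∷ x ++ a ∷ reverse x ++ a ∷ [])) → ⊥
  go [] {i} v≡ = w-squareFree i 1 (s≤s z≤n) (s≤s (s≤s z≤n))
    (trans (sym (infix-window w i [] (a ∷ []) _ v≡)) (infix-window w i (a ∷ []) (a ∷ []) _ v≡))
  go (b ∷ []) {i} v≡ = w-squareFree i 2 (s≤s z≤n) (s≤s (s≤s (s≤s z≤n)))
    (trans (sym (infix-window w i [] (a ∷ b ∷ []) _ v≡)) (infix-window w i (a ∷ b ∷ []) (a ∷ b ∷ []) _ v≡))
  go x@(_ ∷ _ ∷ _) {i} v≡ = split (reverse (a ∷ x)) refl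
    (≤-trans (s≤s (s≤s (s≤s z≤n))) (≤-reflexive (sym (List.length-reverse (a ∷ x)))))
    where
    split : ∀ z → reverse (a ∷ x) ≡ z → 3 ≤ length z → ⊥
    split (c ∷ d ∷ e ∷ z) z≡ _ = w-palindromeFree (length (reverse z) + i)
      (subst (λ u → reverse u ≡ u) (infix-window w i (reverse z) (e ∷ d ∷ c ∷ a ∷ c ∷ d ∷ e ∷ []) z
        (subst (λ v → v ≡ window w i (length v)) v≡centre v≡)) refl)
      where
      v≡centre : a ∷ x ++ a ∷ reverse x ++ a ∷ [] ≡ reverse z ++ (e ∷ d ∷ c ∷ a ∷ c ∷ d ∷ e ∷ []) ++ z
      v≡centre = trans (centre {x = x} z≡)
        (trans (cong (_++ a ∷ c ∷ d ∷ e ∷ z) (List.reverse-++ (c ∷ d ∷ e ∷ []) z))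
        (List.++-assoc (reverse z) (e ∷ d ∷ c ∷ []) _))
    split (_ ∷ [])     _ (s≤s ())
    split (_ ∷ _ ∷ []) _ (s≤s (s≤s ()))

mainTheorem7 : Σ[ w ∈ InfiniteWord (Fin 3) ] ((+ 41 / 22) ⁺-Free) w × AvoidsOverpals w
mainTheorem7 = w , w-powerFree , w-overpalFree
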